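{- Let $k\ge 1$. Every $k$-connected finite graph $G$ has a cycle $C$ with $$\Delta(G\setminus C)\leq \frac{1}{k+1}|G\setminus C|+3.$$
   Context: A single vertex, a single edge, and the empty set are all considered to be cycles. $G\setminus C$ denotes the induced subgraph of $G$ on $V(G)\setminus V(C)$, $|G\setminus C|$ its number of vertices, and $\Delta$ the maximum degree; the maximum degree of the graph with no vertices is taken to be $-\tfrac12$. -}

module Defs where

open import Data.Nat using (ℕ; zero; suc; _+_; _*_; _≤_; _<_; _⊔_)
open import Data.Fin using (Fin)
open import Data.Fin.Properties using (_≟_)
open import Data.Bool using (Bool; true; false; if_then_else_)
open import Data.List using (List; []; _∷_; length; filter; foldr; map; allFin; last; head)
open import Data.List.Relation.Unary.Linked using (Linked)
open import Data.List.Relation.Unary.Unique.Propositional using (Unique)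
open import Data.List.Membership.Propositional using (_∈_; _∉_)
import Data.List.Membership.DecPropositional as DecMem
open import Data.Maybe using (Maybe; just; nothing)
open import Data.Product using (_×_)
open import Relation.Binary.PropositionalEquality using (_≡_)
open import Relation.Nullary using (¬_; does; ¬?)

record Graph : Set where
  field
    n     : ℕ
    adj   : Fin n → Fin n → Bool
    sym   : ∀ u v → adj u v ≡ adj v u
    irrefl : ∀ v → adj v v ≡ false

open Graph public

Adj : (G : Graph) → Fin (n G) → Fin (n G) → Set
Adj G u v = adj G u v ≡ true

-- Reachability in G - S (walks all of whose vertices after the start avoid S).
data Reach (G : Graph) (S : List (Fin (n G))) : Fin (n G) → Fin (n G) → Set where
  here : ∀ {u} → Reach G S u u
  step : ∀ {u w v} → Adj G u w → w ∉ S → Reach G S w v → Reach G S u v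

-- G - S is connected (vacuously true if G - S is empty).
ConnectedMinus : (G : Graph) → List (Fin (n G)) → Set
ConnectedMinus G S = ∀ u v → u ∉ S → v ∉ S → Reach G S u v

-- k-connected (Diestel): |G| > k and G - X is connected for every X with |X| < k.
KConnected : ℕ → Graph → Set
KConnected k G = (k < n G) × (∀ (X : List (Fin (n G))) → length X < k → ConnectedMinus G X)

-- A cycle, given by its (distinct) vertex list. Lists of length 0, 1, 2 encode the
-- empty set, a single vertex, and a single edge; length ≥ 3 a genuine cycle
-- v₁ v₂ … v_m v₁.
IsCycle : (G : Graph) → List (Fin (n G)) → Set
IsCycle G C =
  Unique C × Linked (Adj G) C ×
  (3 ≤ length C → ∀ a b → head C ≡ just a → last C ≡ just b → Adj G b a)

outside : (G : Graph) → List (Fin (n G)) → List (Fin (n G))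
outside G C = filter (λ v → ¬? (DecMem._∈?_ (_≟_ {n G}) v C)) (allFin (n G))

sizeMinus : (G : Graph) → List (Fin (n G)) → ℕ
sizeMinus G C = length (outside G C)

degMinus : (G : Graph) → List (Fin (n G)) → Fin (n G) → ℕ
degMinus G C v = length (filter (λ u → Data.Bool._≟_ (adj G v u) true) (outside G C))

-- Δ(G \ C), with value 0 if G \ C is empty.
maxDegMinus : (G : Graph) → List (Fin (n G)) → ℕ
maxDegMinus G C = foldr _⊔_ 0 (map (degMinus G C) (outside G C))

{-# OPTIONS --safe #-}

-- Write W = G ∖ C and choose C, together with a vertex v of maximum degree d in W, minimising lexicographically d,
-- the number of vertices of degree d in W, the size of the component A of v in W, and the length of C.
-- By connectivity at least k vertices of C are attached to A.  Let c be one of them and walk along C from c.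
-- Before the next attached vertex there is a first vertex s such that uncovering everything up to s creates
-- a vertex x of degree at least d (or raises the degree of one that had degree d); otherwise C could be rerouted
-- through A.  As C cannot be shortened, at most 3 neighbours of x lie on this stretch, so x has at least d - 3
-- neighbours in W, and these lie outside A.  If for two attached vertices c, c′ these neighbourhoods met, then
-- a path through A from c to c′ and a path through W ∖ A joining the two stretches would cross to form a better
-- cycle.  Hence |W| ≥ d + k (d - 3).
-- The argument is classical; it proves the double negation, and the existence of C is decidable by finite search.
module Submission where

open import Defs
open import Data.Nat using (ℕ; zero; suc; _+_; _*_; _∸_; _⊔_; _≤_; _<_; z≤n; s≤s; s≤s⁻¹; _≤?_)
open import Data.Nat.Properties
open import Data.Fin using (Fin; zero; suc)
import Data.Fin.Properties as Fin
open import Data.Bool using (true; if_then_else_)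
import Data.Bool
open import Data.List using (List; []; _∷_; [_]; _++_; length; filter; foldr; map; allFin; last; head; reverse)
open import Data.List.Properties using (++-assoc; ++-identityʳ; length-++; filter-++; length-filter; length-tabulate; reverse-++; unfold-reverse; ∷-injective)
open import Data.List.Relation.Unary.All as All using (All; []; _∷_)
import Data.List.Relation.Unary.All.Properties as AllP
open import Data.List.Relation.Unary.Any as Any using (Any; here; there)
open import Data.List.Relation.Unary.AllPairs using ([]; _∷_)
open import Data.List.Relation.Unary.Linked as Linked using (Linked; []; [-]; _∷_)
open import Data.List.Relation.Unary.Unique.Propositional using (Unique)
import Data.List.Relation.Unary.Unique.Propositional.Properties as Unique
import Data.List.Relation.Unary.Unique.DecPropositional as DecUnique
open import Data.List.Membership.Propositional using (_∈_; _∉_; find)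
open import Data.List.Membership.Propositional.Properties
import Data.List.Membership.DecPropositional as DecMem
open import Data.List.Relation.Binary.Permutation.Propositional using (_↭_; ↭-sym; ↭-trans; ↭-reflexive; ↭⇒↭ₛ)
open import Data.List.Relation.Binary.Permutation.Propositional.Properties using (∈-resp-↭; ↭-length; ↭-reverse; ++⁺ˡ; ++⁺ʳ; ++-comm; ++-commutativeMonoid)
import Data.List.Relation.Binary.Permutation.Setoid.Properties as PermS
open import Data.Maybe using (just; nothing)
open import Data.Maybe.Properties using (just-injective)
open import Data.Product using (Σ; ∃; _×_; _,_; proj₁; proj₂)
open import Data.Sum as Sum using (_⊎_; inj₁; inj₂)
open import Data.Empty using (⊥; ⊥-elim)
open import Function using (_∘_; id)
open import Relation.Nullary using (¬_; Dec; yes; no; does; ¬?; contradiction)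
open import Relation.Nullary.Decidable using (_×-dec_; _⊎-dec_; _→-dec_; map′; decidable-stable)
open import Relation.Unary using (Decidable)
open import Relation.Binary.PropositionalEquality as ≡ using (_≡_; _≢_; refl; cong; subst; module ≡-Reasoning)
import Data.Vec as Vec
import Algebra.Solver.CommutativeMonoid as CMSolver

module Solver {A : Set} = CMSolver (++-commutativeMonoid {A = A})

-- Lists without repetition, linked lists and walks.

module _ {A : Set} where

  Unique-resp-↭ : {xs ys : List A} → xs ↭ ys → Unique xs → Unique ys
  Unique-resp-↭ p = PermS.Unique-resp-↭ (≡.setoid A) (↭⇒↭ₛ p)

  Unique-++⁻ʳ : ∀ xs {ys : List A} → Unique (xs ++ ys) → Unique ys
  Unique-++⁻ʳ []       u       = u
  Unique-++⁻ʳ (x ∷ xs) (_ ∷ u) = Unique-++⁻ʳ xs u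

  -- Pigeonhole: delete one occurrence of the head of `xs` from `ys`; no later entry of `xs` is
  -- lost. Degree and component comparisons rest on it.
  Unique-⊆-length : {xs : List A} → Unique xs → ∀ {ys} → (∀ {z} → z ∈ xs → z ∈ ys) → length xs ≤ length ys
  Unique-⊆-length []              _ = z≤n
  Unique-⊆-length {x ∷ xs} (x∉ ∷ u) sub with ∈-∃++ (sub (here refl))
  ... | as , bs , refl = begin
    suc (length xs)              ≤⟨ s≤s (Unique-⊆-length u {as ++ bs} sub′) ⟩
    suc (length (as ++ bs))      ≡⟨ cong suc (length-++ as) ⟩
    suc (length as + length bs)  ≡⟨ +-suc (length as) (length bs) ⟨
    length as + suc (length bs)  ≡⟨ length-++ as ⟨
    length (as ++ x ∷ bs)        ∎
    where
    open ≤-Reasoning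
    sub′ : ∀ {z} → z ∈ xs → z ∈ as ++ bs
    sub′ z∈ with ∈-++⁻ as (sub (there z∈))
    ... | inj₁ z∈as            = ∈-++⁺ˡ z∈as
    ... | inj₂ (here refl)     = contradiction refl (All.lookup x∉ z∈)
    ... | inj₂ (there z∈bs)    = ∈-++⁺ʳ as z∈bs

  last-++ : ∀ xs {y : A} {ys} → last (xs ++ y ∷ ys) ≡ last (y ∷ ys)
  last-++ []           = refl
  last-++ (x ∷ [])     = refl
  last-++ (x ∷ y ∷ xs) = last-++ (y ∷ xs)

  head-++ : ∀ xs {y : A} {ys zs} → head (xs ++ y ∷ ys) ≡ head (xs ++ y ∷ zs)
  head-++ []       = refl
  head-++ (x ∷ xs) = refl

  1≤length-++-∷ : ∀ xs {y : A} {ys} → 1 ≤ length (xs ++ y ∷ ys)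
  1≤length-++-∷ []       = s≤s z≤n
  1≤length-++-∷ (x ∷ xs) = s≤s z≤n

  2≤length-++-∷ : ∀ xs {c : A} u {s r} → 2 ≤ length (xs ++ c ∷ u ++ s ∷ r)
  2≤length-++-∷ []       u = s≤s (1≤length-++-∷ u)
  2≤length-++-∷ (x ∷ xs) u = s≤s (1≤length-++-∷ xs)

  compare-splits : ∀ xs ys {c c′ : A} {m m′} → xs ++ c ∷ m ≡ ys ++ c′ ∷ m′ →
    c ≡ c′ ⊎ (∃ λ w → m ≡ w ++ c′ ∷ m′) ⊎ (∃ λ w → m′ ≡ w ++ c ∷ m)
  compare-splits []       []       refl = inj₁ refl
  compare-splits []       (y ∷ ys) refl = inj₂ (inj₁ (ys , refl))
  compare-splits (x ∷ xs) []       refl = inj₂ (inj₂ (xs , refl))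
  compare-splits (x ∷ xs) (y ∷ ys) eq   = compare-splits xs ys (proj₂ (∷-injective eq))


  module _ {P : A → Set} where

    skip-prefix : ∀ u {r} w {c m} → u ++ r ≡ w ++ c ∷ m → All (¬_ ∘ P) u → P c → ∃ λ w′ → r ≡ w′ ++ c ∷ m
    skip-prefix []      w       eq   _          _  = w , eq
    skip-prefix (x ∷ u) []      refl (¬px ∷ _)  pc = contradiction pc ¬px
    skip-prefix (x ∷ u) (y ∷ w) eq   (_ ∷ ¬pu)  pc = skip-prefix u w (proj₂ (∷-injective eq)) ¬pu pc

  init-prefix : ∀ u {s : A} as {b bs} → u ++ [ s ] ≡ as ++ b ∷ bs → ∃ λ w → u ≡ as ++ w
  init-prefix u        []           eq = u , refl
  init-prefix []       (a ∷ [])     ()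
  init-prefix []       (a ∷ _ ∷ _)  ()
  init-prefix (x ∷ u)  (a ∷ as)     eq with ∷-injective eq
  ... | refl , eq′ with init-prefix u as eq′
  ... | w , refl = w , refl

  module _ {P : A → Set} (P? : Decidable P) where

    filter-split-first : ∀ l {j} → suc j ≤ length (filter P? l) →
      ∃ λ w → ∃ λ e → ∃ λ w′ → l ≡ w ++ e ∷ w′ × P e × j ≤ length (filter P? w′)
    filter-split-first (x ∷ l) le with P? x
    ... | yes px = [] , x , l , refl , px , s≤s⁻¹ le
    ... | no _ with filter-split-first l le
    ... | w , e , w′ , refl , pe , le′ = x ∷ w , e , w′ , refl , pe , le′

    -- The entry `e` is hit number `suc j`, which need not be the last; the `j` hits before it
    -- account for the length of `w`.
    filter-split-last : ∀ j l → suc j ≤ length (filter P? l) →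
      ∃ λ w → ∃ λ e → ∃ λ w′ → l ≡ w ++ e ∷ w′ × P e × j ≤ length w
    filter-split-last j l le with filter-split-first l le
    filter-split-last zero    l le | w , e , w′ , eq , pe , _ = w , e , w′ , eq , pe , z≤n
    filter-split-last (suc j) l le | w , e , w′ , refl , pe , le′ with filter-split-last j w′ le′
    ... | v , f , v′ , refl , pf , j≤ = w ++ e ∷ v , f , v′ , ≡.sym (++-assoc w (e ∷ v) (f ∷ v′)) , pf , bound
      where
      open ≤-Reasoning
      bound : suc j ≤ length (w ++ e ∷ v)
      bound = begin
        suc j                        ≤⟨ s≤s j≤ ⟩
        suc (length v)               ≤⟨ m≤n+m _ (length w) ⟩
        length w + suc (length v)    ≡⟨ length-++ w ⟨
        length (w ++ e ∷ v)          ∎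

  module _ {R : A → A → Set} where

    Linked-++⁻ˡ : ∀ xs {y ys} → Linked R (xs ++ y ∷ ys) → Linked R (xs ++ [ y ])
    Linked-++⁻ˡ []           _       = [-]
    Linked-++⁻ˡ (x ∷ [])     (r ∷ l) = r ∷ [-]
    Linked-++⁻ˡ (x ∷ z ∷ xs) (r ∷ l) = r ∷ Linked-++⁻ˡ (z ∷ xs) l

    Linked-++⁻ʳ : ∀ xs {ys} → Linked R (xs ++ ys) → Linked R ys
    Linked-++⁻ʳ []       l = l
    Linked-++⁻ʳ (x ∷ xs) l = Linked-++⁻ʳ xs (Linked.tail l)

    Linked-glue : ∀ xs {y ys} → Linked R (xs ++ [ y ]) → Linked R (y ∷ ys) → Linked R (xs ++ y ∷ ys)
    Linked-glue []           _       l′ = l′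
    Linked-glue (x ∷ [])     (r ∷ _) l′ = r ∷ l′
    Linked-glue (x ∷ z ∷ xs) (r ∷ l) l′ = r ∷ Linked-glue (z ∷ xs) l l′

    Linked-reverse : (∀ {x y} → R x y → R y x) → ∀ xs → Linked R xs → Linked R (reverse xs)
    Linked-reverse s []           _       = []
    Linked-reverse s (x ∷ [])     _       = [-]
    Linked-reverse s (x ∷ y ∷ xs) (r ∷ l) = subst (Linked R) eq (Linked-glue (reverse xs) l′ (s r ∷ [-]))
      where
      l′ : Linked R (reverse xs ++ [ y ])
      l′ = subst (Linked R) (unfold-reverse y xs) (Linked-reverse s (y ∷ xs) l)
      eq : reverse xs ++ y ∷ x ∷ [] ≡ reverse (x ∷ y ∷ xs)
      eq = begin
        reverse xs ++ y ∷ x ∷ []          ≡⟨ ++-assoc (reverse xs) [ y ] [ x ] ⟨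
        (reverse xs ++ [ y ]) ++ [ x ]    ≡⟨ cong (_++ [ x ]) (unfold-reverse y xs) ⟨
        reverse (y ∷ xs) ++ [ x ]         ≡⟨ unfold-reverse x (y ∷ xs) ⟨
        reverse (x ∷ y ∷ xs)              ∎
        where open ≡-Reasoning

    Linked-init : ∀ xs {y} → Linked R (xs ++ [ y ]) → Linked R xs
    Linked-init []           _       = []
    Linked-init (x ∷ [])     _       = [-]
    Linked-init (x ∷ z ∷ xs) (r ∷ l) = r ∷ Linked-init (z ∷ xs) l

    Linked-snoc : ∀ xs {y} → Linked R xs → (∀ b → last xs ≡ just b → R b y) → Linked R (xs ++ [ y ])
    Linked-snoc []           _       _ = [-]
    Linked-snoc (x ∷ [])     _       j = j x refl ∷ [-]
    Linked-snoc (x ∷ z ∷ xs) (r ∷ l) j = r ∷ Linked-snoc (z ∷ xs) l j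

    Linked-last : ∀ xs {y b} → Linked R (xs ++ [ y ]) → last xs ≡ just b → R b y
    Linked-last (x ∷ [])     (r ∷ _) refl = r
    Linked-last (x ∷ z ∷ xs) (_ ∷ l) eq   = Linked-last (z ∷ xs) l eq

    module _ (P : A → Set) where

      -- `P` is required of interior vertices only, so that a walk may start and end on the cycle
      -- and run outside it.
      data Walk : A → A → Set where
        edge : ∀ {x y} → R x y → Walk x y
        _∷⟨_⟩_ : ∀ {x w y} → R x w → P w → Walk w y → Walk x y

    module _ {P : A → Set} where

      Walk-++ : ∀ {x y z} → Walk P x y → P y → Walk P y z → Walk P x z
      Walk-++ (edge r)         py w′ = r ∷⟨ py ⟩ w′
      Walk-++ (r ∷⟨ pw ⟩ w)    py w′ = r ∷⟨ pw ⟩ Walk-++ w py w′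

      Walk-sym : (∀ {x y} → R x y → R y x) → ∀ {x y} → Walk P x y → Walk P y x
      Walk-sym s (edge r)      = edge (s r)
      Walk-sym s (r ∷⟨ pw ⟩ w) = Walk-++ (Walk-sym s w) pw (edge (s r))

      -- Exposes the first vertex after the start; `Walk⇒Path` can begin there although `P` may fail
      -- at `x`.
      Walk-via : ∀ {x y z} → Walk P x y → P y → Walk P y z → ∃ λ w → R x w × P w × Walk P w z
      Walk-via (edge r)      py w′ = _ , r , py , w′
      Walk-via (r ∷⟨ pw ⟩ w) py w′ = _ , r , pw , Walk-++ w py w′

      -- Loop erasure: if `x` recurs on the path already built, the part from that recurrence on is
      -- kept. The end `y` is exempt from `Unique` because in the uses it lies on the cycle, where
      -- `P` fails.
      Walk⇒Path : (∀ (x y : A) → Dec (x ≡ y)) → ∀ {x y} → P x → Walk P x y →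
        ∃ λ q → Linked R (x ∷ q ++ [ y ]) × Unique (x ∷ q) × All P (x ∷ q)
      Walk⇒Path _≟_ px (edge r) = [] , r ∷ [-] , [] ∷ [] , px ∷ []
      Walk⇒Path _≟_ {x} {y} px (_∷⟨_⟩_ {w = w} r pw wk) with Walk⇒Path _≟_ pw wk
      ... | q , l , u , ps with DecMem._∈?_ _≟_ x (w ∷ q)
      ... | no x∉ = w ∷ q , r ∷ l , AllP.¬Any⇒All¬ _ x∉ ∷ u , px ∷ ps
      ... | yes x∈ with ∈-∃++ x∈
      ... | q₁ , q₂ , eq = q₂ ,
        Linked-++⁻ʳ q₁ (subst (Linked R) (≡.trans (cong (_++ [ y ]) eq) (++-assoc q₁ (x ∷ q₂) [ y ])) l) ,
        Unique-++⁻ʳ q₁ (subst Unique eq u) , AllP.++⁻ʳ q₁ (subst (All P) eq ps)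

-- Double negation commutes with finite conjunction. A proof of `⊥` may therefore treat membership
-- in a component as decidable.
¬¬∀-Dec : ∀ {n} (P : Fin n → Set) → ¬ ¬ (∀ i → Dec (P i))
¬¬∀-Dec {zero}  P k = k (λ ())
¬¬∀-Dec {suc n} P k = ¬¬∀-Dec (P ∘ suc) λ ds →
  let k′ : ¬ Dec (P zero)
      k′ d = k λ { zero → d ; (suc i) → ds i }
  in k′ (no (k′ ∘ yes))

∃-list≤? : ∀ {n} m {P : List (Fin n) → Set} → (∀ C → Dec (P C)) → Dec (∃ λ C → length C ≤ m × P C)
∃-list≤? zero    P? = map′ (λ p → [] , z≤n , p) (λ { ([] , _ , p) → p }) (P? [])
∃-list≤? (suc m) P? = map′
  (λ { (inj₁ p) → [] , z≤n , p ; (inj₂ (x , C , le , p)) → x ∷ C , s≤s le , p })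
  (λ { ([] , _ , p) → inj₁ p ; (x ∷ C , le , p) → inj₂ (x , C , s≤s⁻¹ le , p) })
  (P? [] ⊎-dec Fin.any? (λ x → ∃-list≤? m (P? ∘ (x ∷_))))

-- Degrees and reachability in a graph.

deg : (G : Graph) → Fin (n G) → List (Fin (n G)) → ℕ
deg G z l = length (filter (λ u → Data.Bool._≟_ (adj G z u) true) l)

module InGraph (G : Graph) where

  private
    V = Fin (n G)

  Adj-sym : ∀ {x y : V} → Adj G x y → Adj G y x
  Adj-sym {x} {y} xy = ≡.trans (sym G y x) xy

  Adj? : ∀ x y → Dec (Adj G x y)
  Adj? x y = Data.Bool._≟_ (adj G x y) true

  Adj⇒≢ : ∀ {x y : V} → Adj G x y → x ≢ y
  Adj⇒≢ {x} xy refl with ≡.trans (≡.sym xy) (irrefl G x)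
  ... | ()

  ∈-outside⁺ : ∀ {C z} → z ∉ C → z ∈ outside G C
  ∈-outside⁺ {C} z∉C = ∈-filter⁺ (λ v → ¬? (DecMem._∈?_ Fin._≟_ v C)) (∈-allFin _) z∉C

  ∈-outside⁻ : ∀ {C z} → z ∈ outside G C → z ∉ C
  ∈-outside⁻ {C} z∈ = proj₂ (∈-filter⁻ (λ v → ¬? (DecMem._∈?_ Fin._≟_ v C)) {xs = allFin (n G)} z∈)

  outside-Unique : ∀ C → Unique (outside G C)
  outside-Unique C = Unique.filter⁺ (λ v → ¬? (DecMem._∈?_ Fin._≟_ v C)) (Unique.allFin⁺ (n G))

  deg-++ : ∀ z xs ys → deg G z (xs ++ ys) ≡ deg G z xs + deg G z ys
  deg-++ z xs ys = ≡.trans (cong length (filter-++ (Adj? z) xs ys)) (length-++ (filter (Adj? z) xs))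

  deg-⊆ : ∀ z {xs ys} → Unique xs → (∀ {w} → w ∈ xs → w ∈ ys) → deg G z xs ≤ deg G z ys
  deg-⊆ z {xs} {ys} u sub = Unique-⊆-length (Unique.filter⁺ (Adj? z) u) λ w∈ →
    let w∈xs , zw = ∈-filter⁻ (Adj? z) {xs = xs} w∈ in ∈-filter⁺ (Adj? z) (sub w∈xs) zw

  deg-positive : ∀ z l → deg G z l ≡ 0 ⊎ ∃ λ w → w ∈ l × Adj G z w
  deg-positive z []      = inj₁ refl
  deg-positive z (x ∷ l) with Adj? z x
  ... | yes zx = inj₂ (x , here refl , zx)
  ... | no _ with deg-positive z l
  ... | inj₁ eq           = inj₁ eq
  ... | inj₂ (w , w∈ , a) = inj₂ (w , there w∈ , a)

  Reach-snoc : ∀ {S} {x a z : V} → Reach G S x a → Adj G a z → z ∉ S → Reach G S x z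
  Reach-snoc here            az z∉ = step az z∉ here
  Reach-snoc (step xw w∉ r)  az z∉ = step xw w∉ (Reach-snoc r az z∉)

  Reach-avoids : ∀ {S} {x a : V} → x ∉ S → Reach G S x a → a ∉ S
  Reach-avoids x∉ here          = x∉
  Reach-avoids x∉ (step _ w∉ r) = Reach-avoids w∉ r

  Reach⇒Walk : ∀ {S} {v x a c : V} → Reach G S v x → Reach G S x a → Adj G a c → Walk {R = Adj G} (Reach G S v) x c
  Reach⇒Walk vx here           ac = edge ac
  Reach⇒Walk vx (step xw w∉ r) ac = xw ∷⟨ vw ⟩ Reach⇒Walk vw r ac
    where vw = Reach-snoc vx xw w∉

-- Attached vertices, harmless uncovering and minimality.

Attached : (G : Graph) (C : List (Fin (n G))) (v c : Fin (n G)) → Set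
Attached G C v c = ∃ λ a → Reach G C v a × Adj G c a

-- Degrees are taken in all of `outside G C ++ u`, ignoring what a new cycle covers instead of `u`.
-- So the condition does not depend on the rerouting, and it passes to segments of `u`.
Harmless : (G : Graph) (C : List (Fin (n G))) (cap : Fin (n G) → ℕ) → List (Fin (n G)) → Set
Harmless G C cap u = All (λ z → deg G z (outside G C ++ u) < cap z) (outside G C ++ u)

-- The form in which minimality is used. That `u` is unattached keeps the component of `v` from
-- growing; progress means covering one of its vertices or shortening the cycle.
NoImprovement : (G : Graph) (C : List (Fin (n G))) (v : Fin (n G)) (cap : Fin (n G) → ℕ) → Set
NoImprovement G C v cap = ∀ C′ u → IsCycle G C′ → Harmless G C cap u → All (¬_ ∘ Attached G C v) u →
  (∀ {z} → z ∈ C → z ∈ C′ ⊎ z ∈ u) →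
  ((∃ λ a → Reach G C v a × a ∈ C′) ⊎ length C′ < length C) → ⊥

-- `D` is `C` rotated to start at an attached vertex. Hence each stretch between attached vertices
-- is a segment of the list, and the one after the last of them leads back to the head.
module Extremal
  (G : Graph) (C D : List (Fin (n G))) (D↭C : D ↭ C) (C-unique : Unique C) (D-linked : Linked (Adj G) D)
  (D-closed : 2 ≤ length D → ∀ a b → head D ≡ just a → last D ≡ just b → Adj G b a)
  (v : Fin (n G)) (v∉C : v ∉ C) (A? : ∀ z → Dec (Reach G C v z))
  (head-attached : ∀ h → head D ≡ just h → Attached G C v h)
  (d : ℕ) (cap : Fin (n G) → ℕ) (d≤cap : ∀ z → d ≤ cap z)
  (harmless-[] : Harmless G C cap [])
  (no-improvement : NoImprovement G C v cap) where

  open InGraph G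

  private
    V = Fin (n G)

    W : List V
    W = outside G C

    A : V → Set
    A = Reach G C v

    Att OK : _ → Set
    Att = Attached G C v
    OK  = λ u → Harmless G C cap u

  Free : V → Set
  Free z = z ∉ C × ¬ A z

  A⇒∉C : ∀ {a} → A a → a ∉ C
  A⇒∉C = Reach-avoids v∉C

  Att? : ∀ c → Dec (Att c)
  Att? c = Fin.any? (λ a → A? a ×-dec Adj? c a)

  OK? : ∀ u → Dec (OK u)
  OK? u = All.all? (λ z → suc (deg G z (W ++ u)) ≤? cap z) (W ++ u)

  ¬OK⇒witness : ∀ u → ¬ OK u → ∃ λ z → z ∈ W ++ u × cap z ≤ deg G z (W ++ u)
  ¬OK⇒witness u ¬ok with find (AllP.¬All⇒Any¬ (λ z → suc (deg G z (W ++ u)) ≤? cap z) (W ++ u) ¬ok)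
  ... | z , z∈ , ¬lt = z , z∈ , ≮⇒≥ ¬lt

  -- Uncovering part of the cycle and rerouting it.

  deg-W++ : ∀ z as w bs → deg G z (W ++ w) ≤ deg G z (W ++ as ++ w ++ bs)
  deg-W++ z as w bs = begin
    deg G z (W ++ w)                        ≡⟨ deg-++ z W w ⟩
    deg G z W + deg G z w                   ≤⟨ +-monoʳ-≤ (deg G z W) (≤-trans (m≤m+n (deg G z w) (deg G z bs)) (m≤n+m _ (deg G z as))) ⟩
    deg G z W + (deg G z as + (deg G z w + deg G z bs)) ≡⟨ cong (λ m → deg G z W + (deg G z as + m)) (deg-++ z w bs) ⟨
    deg G z W + (deg G z as + deg G z (w ++ bs)) ≡⟨ cong (deg G z W +_) (deg-++ z as (w ++ bs)) ⟨
    deg G z W + deg G z (as ++ w ++ bs)     ≡⟨ deg-++ z W (as ++ w ++ bs) ⟨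
    deg G z (W ++ as ++ w ++ bs)            ∎
    where open ≤-Reasoning

  OK-infix : ∀ as w bs → OK (as ++ w ++ bs) → OK w
  OK-infix as w bs ok = All.tabulate λ {z} z∈ → ≤-<-trans (deg-W++ z as w bs) (All.lookup ok (sub (∈-++⁻ W z∈)))
    where
    sub : ∀ {z} → z ∈ W ⊎ z ∈ w → z ∈ W ++ as ++ w ++ bs
    sub (inj₁ z∈) = ∈-++⁺ˡ z∈
    sub (inj₂ z∈) = ∈-++⁺ʳ W (∈-++⁺ʳ as (∈-++⁺ˡ z∈))

  OK-prefix : ∀ w bs → OK (w ++ bs) → OK w
  OK-prefix = OK-infix []

  -- Before `w` was uncovered the degree of `z` was below `cap z`, so `w` must contribute.
  new-neighbour : ∀ {z} u w → z ∈ W ++ u → OK u → cap z ≤ deg G z (W ++ u) + deg G z w → ∃ λ e → e ∈ w × Adj G z e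
  new-neighbour {z} u w z∈ ok le with deg-positive z w
  ... | inj₂ found = found
  ... | inj₁ eq = ⊥-elim (<⇒≱ (All.lookup ok z∈) (≤-trans le (≤-reflexive (≡.trans (cong (deg G z (W ++ u) +_) eq) (+-identityʳ _)))))

  -- `U` is uncovered, `N` newly covered, `K` kept. Sets matter only up to permutation; the order of
  -- `C′` enters through linkedness and closure alone.
  reroute : ∀ {C′} U N K → D ↭ U ++ K → C′ ↭ N ++ K → Unique N → All (_∉ C) N →
    Linked (Adj G) C′ → (∀ a b → head C′ ≡ just a → last C′ ≡ just b → Adj G b a) →
    OK U → All (¬_ ∘ Att) U → ((∃ λ a → A a × a ∈ N) ⊎ length N < length U) → ⊥
  reroute {C′} U N K D↭ C′↭ uN N∉C lk cl ok ¬att prog =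
    no-improvement C′ U (Unique-resp-↭ (↭-sym C′↭) uNK , lk , λ _ → cl) ok ¬att cover (progress prog)
    where
    C↭ : C ↭ U ++ K
    C↭ = ↭-trans (↭-sym D↭C) D↭
    uNK : Unique (N ++ K)
    uNK = Unique.++⁺ uN (Unique-++⁻ʳ U (Unique-resp-↭ C↭ C-unique)) λ { (z∈N , z∈K) →
      All.lookup N∉C z∈N (∈-resp-↭ (↭-sym C↭) (∈-++⁺ʳ U z∈K)) }
    cover : ∀ {z} → z ∈ C → z ∈ C′ ⊎ z ∈ U
    cover z∈ with ∈-++⁻ U (∈-resp-↭ C↭ z∈)
    ... | inj₁ z∈U = inj₂ z∈U
    ... | inj₂ z∈K = inj₁ (∈-resp-↭ (↭-sym C′↭) (∈-++⁺ʳ N z∈K))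
    progress : (∃ λ a → A a × a ∈ N) ⊎ length N < length U → (∃ λ a → A a × a ∈ C′) ⊎ length C′ < length C
    progress (inj₁ (a , Aa , a∈N)) = inj₁ (a , Aa , ∈-resp-↭ (↭-sym C′↭) (∈-++⁺ˡ a∈N))
    progress (inj₂ lt) = inj₂ (begin-strict
      length C′             ≡⟨ ≡.trans (↭-length C′↭) (length-++ N) ⟩
      length N + length K   <⟨ +-monoˡ-< (length K) lt ⟩
      length U + length K   ≡⟨ ≡.trans (↭-length C↭) (length-++ U) ⟨
      length C              ∎)
      where open ≤-Reasoning

  -- Goes from `c` to `v` and on to `c′` inside the component, then erases loops. The path has an
  -- inner vertex even if `c` and `c′` coincide or are adjacent.
  path-through-A : ∀ {c c′} → Att c → Att c′ →
    ∃ λ p → Linked (Adj G) (c ∷ p ++ [ c′ ]) × Unique p × All A p × (∃ λ a → A a × a ∈ p)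
  path-through-A (a , Aa , ca) (a′ , Aa′ , ca′)
    with Walk-via (Walk-sym Adj-sym (Reach⇒Walk here Aa (Adj-sym ca))) here (Reach⇒Walk here Aa′ (Adj-sym ca′))
  ... | w , cw , Aw , wk with Walk⇒Path Fin._≟_ Aw wk
  ... | q , l , u , ps = w ∷ q , cw ∷ l , u , ps , w , Aw , here refl

  module _ {xs : List V} {e : V} {w : List V} {f : V} {r : List V} (eq : D ≡ xs ++ e ∷ w ++ f ∷ r) where

    private
      shift : ∀ w → xs ++ e ∷ w ++ f ∷ r ↭ w ++ (xs ++ e ∷ f ∷ r)
      shift w = prove 4 (X ⊕ (E ⊕ (M ⊕ R))) (M ⊕ (X ⊕ (E ⊕ R))) (xs Vec.∷ [ e ] Vec.∷ w Vec.∷ (f ∷ r) Vec.∷ Vec.[])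
        where
        open Solver {A = V}
        X = var zero
        E = var (suc zero)
        M = var (suc (suc zero))
        R = var (suc (suc (suc zero)))

      D-linked′ : Linked (Adj G) (xs ++ e ∷ w ++ f ∷ r)
      D-linked′ = subst (Linked (Adj G)) eq D-linked

    -- The ends `e` and `f` stay, so head and last vertex of `D` are unchanged. This serves both
    -- detours through the component and shortcuts.
    replace-segment : ∀ q → Linked (Adj G) (e ∷ q ++ [ f ]) → Unique q → All (_∉ C) q →
      OK w → All (¬_ ∘ Att) w → ((∃ λ a → A a × a ∈ q) ⊎ length q < length w) → ⊥
    replace-segment q lq uq q∉C ok ¬att =
      reroute {xs ++ e ∷ q ++ f ∷ r} w q (xs ++ e ∷ f ∷ r)
        (↭-trans (↭-reflexive eq) (shift w)) (shift q) uq q∉C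
        (Linked-glue xs (Linked-++⁻ˡ xs D-linked′)
          (Linked-glue (e ∷ q) lq (Linked-++⁻ʳ (e ∷ w) (Linked-++⁻ʳ xs D-linked′))))
        (λ a b ha lb → D-closed (subst (λ l → 2 ≤ length l) (≡.sym eq) (2≤length-++-∷ xs w)) a b
          (≡.trans (cong head eq) (≡.trans (head-++ xs) ha))
          (≡.trans (cong last eq) (≡.trans (≡.trans (last-++ xs) (last-++ (e ∷ w)))
            (≡.trans (≡.sym (≡.trans (last-++ xs) (last-++ (e ∷ q)))) lb))))
        ok ¬att

  -- Otherwise the stretch could be exchanged for a path through the component, covering one of its
  -- vertices.
  segment-harmful : ∀ xs {c} t {c′ r} → D ≡ xs ++ c ∷ t ++ c′ ∷ r → Att c → Att c′ → All (¬_ ∘ Att) t → ¬ OK t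
  segment-harmful xs t eq ac ac′ ¬att ok with path-through-A ac ac′
  ... | p , lp , up , Ap , a = replace-segment eq p lp up (All.map A⇒∉C Ap) ok ¬att (inj₁ a)

  -- The stretch after the last attached vertex would be bypassed by a path through the component to
  -- the head of `D`.
  last-segment-harmful : ∀ xs {c} t → D ≡ xs ++ c ∷ t → Att c → All (¬_ ∘ Att) t → ¬ OK t
  last-segment-harmful xs {c} t eq ac ¬att ok = go (xs ++ [ c ]) refl
    where
    h∈ : ∀ l → l ≡ xs ++ [ c ] → ∃ λ h → head l ≡ just h
    h∈ []      e with () ← subst (1 ≤_) (cong length (≡.sym e)) (1≤length-++-∷ xs)
    h∈ (h ∷ _) e = h , refl
    go : ∀ l → l ≡ xs ++ [ c ] → ⊥
    go l refl with h∈ l refl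
    -- If `c` is itself the head then `h` is `c`, and the new cycle, possibly a single edge, returns
    -- to `c` through the component.
    ... | h , hh with path-through-A ac (head-attached h (≡.trans (cong head eq) (≡.trans (head-++ xs) hh)))
    ... | p@(_ ∷ p′) , lp , up , Ap , a =
      reroute {xs ++ c ∷ p} t p (xs ++ [ c ]) (↭-trans (↭-reflexive eq) (shift t)) (shift p) up (All.map A⇒∉C Ap)
        (Linked-glue xs (Linked-++⁻ˡ xs (subst (Linked (Adj G)) eq D-linked)) (Linked-init (c ∷ p) lp))
        (λ a b ha lb → subst (Adj G b) (just-injective (≡.trans (≡.sym hh) (≡.trans (head-++ xs) ha)))
          (Linked-last (c ∷ p) lp (≡.trans (≡.sym (last-++ xs)) lb)))
        ok ¬att (inj₁ a)
      where
      shift : ∀ w → xs ++ c ∷ w ↭ w ++ (xs ++ [ c ])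
      shift w = prove 3 (X ⊕ (E ⊕ M)) (M ⊕ (X ⊕ E)) (xs Vec.∷ [ c ] Vec.∷ w Vec.∷ Vec.[])
        where
        open Solver {A = V}
        X = var zero
        E = var (suc zero)
        M = var (suc (suc zero))
    ... | [] , _ , _ , _ , _ , _ , ()

  -- The new cycle runs c - A - c′ - M backwards - s - s′, uncovering u and u′.  If uncovering both is harmful, then u
  -- and u′ are joined by an edge or through a vertex of W, which gives a crossing closer to c and c′.
  crossing : ∀ fuel xs c u s M c′ u′ s′ M′ → length u + length u′ < fuel →
    D ≡ xs ++ c ∷ u ++ s ∷ M ++ c′ ∷ u′ ++ s′ ∷ M′ →
    Att c → Att c′ → All (¬_ ∘ Att) u → ¬ Att s → All (¬_ ∘ Att) u′ → ¬ Att s′ →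
    OK u → OK u′ → Walk {R = Adj G} Free s s′ → ⊥
  crossing (suc fuel) xs c u s M c′ u′ s′ M′ lt eq ac ac′ ¬u ¬s ¬u′ ¬s′ oku oku′ wk with OK? (u ++ u′)
  ... | no ¬ok = descend
    where
    shorter : ∀ {e e′} → e ∈ u → e′ ∈ u′ → Walk {R = Adj G} Free e e′ → ⊥
    shorter {e} {e′} e∈ e′∈ wk′ with ∈-∃++ e∈ | ∈-∃++ e′∈
    ... | u₁ , u₂ , refl | u₁′ , u₂′ , refl =
      crossing fuel xs c u₁ e (u₂ ++ s ∷ M) c′ u₁′ e′ (u₂′ ++ s′ ∷ M′) lt′ eq′ ac ac′
        (AllP.++⁻ˡ u₁ ¬u) (All.head (AllP.++⁻ʳ u₁ ¬u)) (AllP.++⁻ˡ u₁′ ¬u′) (All.head (AllP.++⁻ʳ u₁′ ¬u′))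
        (OK-prefix u₁ (e ∷ u₂) oku) (OK-prefix u₁′ (e′ ∷ u₂′) oku′) wk′
      where
      lt′ : length u₁ + length u₁′ < fuel
      lt′ = s≤s⁻¹ (begin-strict
        suc (length u₁ + length u₁′) ≤⟨ +-mono-≤ (m<len u₁ e u₂) (≤-trans (n≤1+n _) (m<len u₁′ e′ u₂′)) ⟩
        length (u₁ ++ e ∷ u₂) + length (u₁′ ++ e′ ∷ u₂′) <⟨ lt ⟩
        suc fuel ∎)
        where
        open ≤-Reasoning
        m<len : ∀ as (b : V) bs → length as < length (as ++ b ∷ bs)
        m<len []       b bs = s≤s z≤n
        m<len (x ∷ as) b bs = s≤s (m<len as b bs)
      eq′ : D ≡ xs ++ c ∷ u₁ ++ e ∷ (u₂ ++ s ∷ M) ++ c′ ∷ u₁′ ++ e′ ∷ u₂′ ++ s′ ∷ M′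
      eq′ = ≡.trans eq (cong (λ l → xs ++ c ∷ l) (begin
        (u₁ ++ e ∷ u₂) ++ s ∷ M ++ c′ ∷ (u₁′ ++ e′ ∷ u₂′) ++ s′ ∷ M′
          ≡⟨ ++-assoc u₁ (e ∷ u₂) _ ⟩
        u₁ ++ e ∷ u₂ ++ s ∷ M ++ c′ ∷ (u₁′ ++ e′ ∷ u₂′) ++ s′ ∷ M′
          ≡⟨ cong (λ l → u₁ ++ e ∷ u₂ ++ s ∷ M ++ c′ ∷ l) (++-assoc u₁′ (e′ ∷ u₂′) _) ⟩
        u₁ ++ e ∷ u₂ ++ s ∷ M ++ c′ ∷ u₁′ ++ e′ ∷ u₂′ ++ s′ ∷ M′
          ≡⟨ cong (λ l → u₁ ++ e ∷ l) (++-assoc u₂ (s ∷ M) _) ⟨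
        u₁ ++ e ∷ (u₂ ++ s ∷ M) ++ c′ ∷ u₁′ ++ e′ ∷ u₂′ ++ s′ ∷ M′ ∎))
        where open ≡-Reasoning
    descend : ⊥
    descend with ¬OK⇒witness (u ++ u′) ¬ok
    ... | z , z∈ , le = cases (∈-++⁻ W z∈)
      where
      -- The degree is split in both orders, since the harmlessness of either part may be the one
      -- used.
      le₁ : cap z ≤ deg G z (W ++ u) + deg G z u′
      le₁ = ≤-trans le (≤-reflexive (≡.trans (cong (deg G z) (≡.sym (++-assoc W u u′))) (deg-++ z (W ++ u) u′)))
      le₂ : cap z ≤ deg G z (W ++ u′) + deg G z u
      le₂ = ≤-trans le (≤-reflexive (begin
        deg G z (W ++ u ++ u′)                     ≡⟨ deg-++ z W (u ++ u′) ⟩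
        deg G z W + deg G z (u ++ u′)              ≡⟨ cong (deg G z W +_) (deg-++ z u u′) ⟩
        deg G z W + (deg G z u + deg G z u′)       ≡⟨ cong (deg G z W +_) (+-comm (deg G z u) _) ⟩
        deg G z W + (deg G z u′ + deg G z u)       ≡⟨ +-assoc (deg G z W) _ _ ⟨
        deg G z W + deg G z u′ + deg G z u         ≡⟨ cong (_+ deg G z u) (deg-++ z W u′) ⟨
        deg G z (W ++ u′) + deg G z u              ∎))
        where open ≡-Reasoning
      cases : z ∈ W ⊎ z ∈ u ++ u′ → ⊥
      -- `z` has a neighbour in both parts, and it is not in the component of `v` because `e` is
      -- unattached; so it links `e` to `e′` freely.
      cases (inj₁ z∈W) with new-neighbour u u′ (∈-++⁺ˡ z∈W) oku le₁ | new-neighbour u′ u (∈-++⁺ˡ z∈W) oku′ le₂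
      ... | e′ , e′∈ , ze′ | e , e∈ , ze = shorter e∈ e′∈
        (Adj-sym ze ∷⟨ ∈-outside⁻ z∈W , (λ Az → All.lookup ¬u e∈ (z , Az , Adj-sym ze)) ⟩ edge ze′)
      cases (inj₂ z∈uu′) with ∈-++⁻ u z∈uu′
      ... | inj₁ z∈u with new-neighbour u u′ (∈-++⁺ʳ W z∈u) oku le₁
      ...   | e′ , e′∈ , ze′ = shorter z∈u e′∈ (edge ze′)
      cases (inj₂ z∈uu′) | inj₂ z∈u′ with new-neighbour u′ u (∈-++⁺ʳ W z∈u′) oku′ le₂
      ...   | e , e∈ , ze = shorter e∈ z∈u′ (edge (Adj-sym ze))
  ... | yes ok = close (path-through-A ac ac′) (simple wk)
    where
    simple : Walk {R = Adj G} Free s s′ → ∃ λ q → Linked (Adj G) (s ∷ q ++ [ s′ ]) × Unique q × All Free q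
    simple (edge ss′) = [] , ss′ ∷ [-] , [] , []
    simple (_∷⟨_⟩_ {w = w} sw fw wk′) with Walk⇒Path Fin._≟_ fw wk′
    ... | q , l , uq , fq = w ∷ q , sw ∷ l , uq , fq
    close : (∃ λ p → Linked (Adj G) (c ∷ p ++ [ c′ ]) × Unique p × All A p × (∃ λ a → A a × a ∈ p)) →
      (∃ λ q → Linked (Adj G) (s ∷ q ++ [ s′ ]) × Unique q × All Free q) → ⊥
    close (p , lp , up , Ap , a , Aa , a∈p) (q , lq , uq , fq) =
      reroute {C′} (u ++ u′) (p ++ q) K D↭ C′↭
        (Unique.++⁺ up uq (λ { (z∈p , z∈q) → proj₂ (All.lookup fq z∈q) (All.lookup Ap z∈p) }))
        (AllP.++⁺ (All.map A⇒∉C Ap) (All.map proj₁ fq))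
        linked closed ok (AllP.++⁺ ¬u ¬u′) (inj₁ (a , Aa , ∈-++⁺ˡ a∈p))
      where
      C′ rest K : List V
      C′ = xs ++ c ∷ p ++ c′ ∷ reverse M ++ s ∷ q ++ s′ ∷ M′
      rest = xs ++ c ∷ c′ ∷ s ∷ s′ ∷ M′
      K = reverse M ++ rest
      open Solver {A = V}
      v0 = var zero
      v1 = var (suc zero)
      v2 = var (suc (suc zero))
      v3 = var (suc (suc (suc zero)))
      v4 = var (suc (suc (suc (suc zero))))
      v5 = var (suc (suc (suc (suc (suc zero)))))
      v6 = var (suc (suc (suc (suc (suc (suc zero))))))
      v7 = var (suc (suc (suc (suc (suc (suc (suc zero)))))))
      D↭ : D ↭ (u ++ u′) ++ K
      D↭ = ↭-trans (↭-reflexive eq) (↭-trans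
        (prove 8 (v0 ⊕ (v1 ⊕ (v2 ⊕ (v3 ⊕ (v4 ⊕ (v5 ⊕ (v6 ⊕ v7)))))))
                 ((v2 ⊕ v6) ⊕ (v4 ⊕ (v0 ⊕ (v1 ⊕ (v5 ⊕ (v3 ⊕ v7))))))
          (xs Vec.∷ [ c ] Vec.∷ u Vec.∷ [ s ] Vec.∷ M Vec.∷ [ c′ ] Vec.∷ u′ Vec.∷ (s′ ∷ M′) Vec.∷ Vec.[]))
        (++⁺ˡ (u ++ u′) (++⁺ʳ rest (↭-sym (↭-reverse M)))))
      C′↭ : C′ ↭ (p ++ q) ++ K
      C′↭ = prove 8 (v0 ⊕ (v1 ⊕ (v2 ⊕ (v5 ⊕ (v4 ⊕ (v3 ⊕ (v6 ⊕ v7)))))))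
                    ((v2 ⊕ v6) ⊕ (v4 ⊕ (v0 ⊕ (v1 ⊕ (v5 ⊕ (v3 ⊕ v7))))))
          (xs Vec.∷ [ c ] Vec.∷ p Vec.∷ [ s ] Vec.∷ reverse M Vec.∷ [ c′ ] Vec.∷ q Vec.∷ (s′ ∷ M′) Vec.∷ Vec.[])
      l₀ = subst (Linked (Adj G)) eq D-linked
      l₁ : Linked (Adj G) (s ∷ M ++ c′ ∷ u′ ++ s′ ∷ M′)
      l₁ = Linked-++⁻ʳ (c ∷ u) (Linked-++⁻ʳ xs l₀)
      l₂ : Linked (Adj G) (s′ ∷ M′)
      l₂ = Linked-++⁻ʳ (c′ ∷ u′) (Linked-++⁻ʳ (s ∷ M) l₁)
      back : Linked (Adj G) (c′ ∷ reverse M ++ [ s ])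
      back = subst (Linked (Adj G))
        (≡.trans (reverse-++ (s ∷ M) [ c′ ]) (cong (c′ ∷_) (unfold-reverse s M)))
        (Linked-reverse Adj-sym (s ∷ M ++ [ c′ ]) (Linked-++⁻ˡ (s ∷ M) l₁))
      linked : Linked (Adj G) C′
      linked = Linked-glue xs (Linked-++⁻ˡ xs l₀) (Linked-glue (c ∷ p) lp
        (Linked-glue (c′ ∷ reverse M) back (Linked-glue (s ∷ q) lq l₂)))
      last-D : last D ≡ last (s′ ∷ M′)
      last-D = ≡.trans (cong last eq) (≡.trans (last-++ xs) (≡.trans (last-++ (c ∷ u)) (≡.trans (last-++ (s ∷ M)) (last-++ (c′ ∷ u′)))))
      last-C′ : last C′ ≡ last (s′ ∷ M′)
      last-C′ = ≡.trans (last-++ xs) (≡.trans (last-++ (c ∷ p)) (≡.trans (last-++ (c′ ∷ reverse M)) (last-++ (s ∷ q))))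
      closed : ∀ a b → head C′ ≡ just a → last C′ ≡ just b → Adj G b a
      closed a b ha lb = D-closed (subst (λ l → 2 ≤ length l) (≡.sym eq) (2≤length-++-∷ xs u)) a b
        (≡.trans (cong head eq) (≡.trans (head-++ xs) ha)) (≡.trans last-D (≡.trans (≡.sym last-C′) lb))

  -- Collects what `crossing` needs on the side of one attached vertex; two territories meeting in
  -- `z` supply the joining walk.
  record Territory (c z : V) : Set where
    constructor territory
    field
      {before stretch after} : List V
      {exit} : V
      split    : D ≡ before ++ c ∷ stretch ++ exit ∷ after
      stretch-unattached : All (¬_ ∘ Att) stretch
      exit-unattached : ¬ Att exit
      harmless : OK stretch
      free     : Free z
      walk     : Walk {R = Adj G} Free exit z

  private module T = Territory

  -- The walks from both exits to `z` join them, and `crossing` applies. As the stretch after `c` is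
  -- unattached, `c′` lies beyond it.
  ordered-territories-disjoint : ∀ {c c′ z} → Att c → Att c′ → (t : Territory c z) (t′ : Territory c′ z) →
    ∀ w → T.stretch t ++ T.exit t ∷ T.after t ≡ w ++ c′ ∷ T.stretch t′ ++ T.exit t′ ∷ T.after t′ → ⊥
  ordered-territories-disjoint {c} {c′} ac ac′ t t′ w eq
    with skip-prefix {P = Att} (T.stretch t) w eq (T.stretch-unattached t) ac′
  -- Here `c′` would be the exit itself.
  ... | [] , refl = T.exit-unattached t ac′
  ... | _ ∷ M , refl = crossing _ (T.before t) c (T.stretch t) (T.exit t) M c′ (T.stretch t′) (T.exit t′) (T.after t′)
    ≤-refl (T.split t) ac ac′ (T.stretch-unattached t) (T.exit-unattached t) (T.stretch-unattached t′) (T.exit-unattached t′)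
    (T.harmless t) (T.harmless t′) (Walk-++ (T.walk t) (T.free t) (Walk-sym Adj-sym (T.walk t′)))

  territories-disjoint : ∀ {c c′ z} → Att c → Att c′ → c ≢ c′ → Territory c z → Territory c′ z → ⊥
  territories-disjoint ac ac′ c≢c′ t t′
    with compare-splits (T.before t) (T.before t′) (≡.trans (≡.sym (T.split t)) (T.split t′))
  ... | inj₁ c≡c′            = c≢c′ c≡c′
  ... | inj₂ (inj₁ (w , eq)) = ordered-territories-disjoint ac ac′ t t′ w eq
  ... | inj₂ (inj₂ (w , eq)) = ordered-territories-disjoint ac′ ac t′ t w eq

  -- Vertices after `c` are uncovered one at a time. While this is harmless, neither an attached
  -- vertex nor the end of `D` can come next, by `segment-harmful` and `last-segment-harmful`.
  find-exit : ∀ xs c u ys → D ≡ xs ++ c ∷ u ++ ys → Att c → All (¬_ ∘ Att) u → OK u →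
    ∃ λ u′ → ∃ λ s → ∃ λ r → D ≡ xs ++ c ∷ u′ ++ s ∷ r × All (¬_ ∘ Att) u′ × ¬ Att s × OK u′ × ¬ OK (u′ ++ [ s ])
  find-exit xs c u [] eq ac ¬u ok =
    ⊥-elim (last-segment-harmful xs u (≡.trans eq (cong (λ l → xs ++ c ∷ l) (++-identityʳ u))) ac ¬u ok)
  find-exit xs c u (y ∷ ys) eq ac ¬u ok with Att? y
  ... | yes ay = ⊥-elim (segment-harmful xs u eq ac ay ¬u ok)
  ... | no ¬ay with OK? (u ++ [ y ])
  ...   | no ¬ok = u , y , ys , eq , ¬u , ¬ay , ok , ¬ok
  ...   | yes ok′ = find-exit xs c (u ++ [ y ]) ys
    (≡.trans eq (cong (λ l → xs ++ c ∷ l) (≡.sym (++-assoc u [ y ] ys)))) ac (AllP.++⁺ ¬u (¬ay ∷ [])) ok′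

  -- The stretch from an attached vertex to the first harmful one.

  module _ {xs c u s r} (eq : D ≡ xs ++ c ∷ u ++ s ∷ r) (¬u : All (¬_ ∘ Att) u) (¬s : ¬ Att s) (ok : OK u) where

    -- As `f` comes after `w`, the bypassed `w` lies within the harmless unattached `u` even when
    -- `f` is `s`; a shorter `q` would shorten the cycle.
    no-shortcut : ∀ w₁ e w f w₃ → u ++ [ s ] ≡ w₁ ++ e ∷ w ++ f ∷ w₃ →
      ∀ q → Linked (Adj G) (e ∷ q ++ [ f ]) → Unique q → All (_∉ C) q → ¬ length q < length w
    no-shortcut w₁ e w f w₃ eq₁ q lq uq q∉C lt
      with init-prefix u (w₁ ++ e ∷ w) (≡.trans eq₁ (≡.sym (++-assoc w₁ (e ∷ w) (f ∷ w₃))))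
    ... | w′ , eq₂ = replace-segment {xs ++ c ∷ w₁} {e} {w} {f} {w₃ ++ r} D≡ q lq uq q∉C
        (OK-infix (w₁ ++ [ e ]) w w′ (subst OK u≡ ok))
        (AllP.++⁻ˡ w (AllP.++⁻ʳ (w₁ ++ [ e ]) (subst (All (¬_ ∘ Att)) u≡ ¬u))) (inj₂ lt)
      where
      open ≡-Reasoning
      u≡ : u ≡ (w₁ ++ [ e ]) ++ w ++ w′
      u≡ = begin
        u                            ≡⟨ eq₂ ⟩
        (w₁ ++ e ∷ w) ++ w′          ≡⟨ ++-assoc w₁ (e ∷ w) w′ ⟩
        w₁ ++ e ∷ w ++ w′            ≡⟨ ++-assoc w₁ [ e ] (w ++ w′) ⟨
        (w₁ ++ [ e ]) ++ w ++ w′     ∎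
      D≡ : D ≡ (xs ++ c ∷ w₁) ++ e ∷ w ++ f ∷ w₃ ++ r
      D≡ = begin
        D                                         ≡⟨ eq ⟩
        xs ++ c ∷ u ++ s ∷ r                      ≡⟨ cong (λ l → xs ++ c ∷ l) (++-assoc u [ s ] r) ⟨
        xs ++ c ∷ (u ++ [ s ]) ++ r               ≡⟨ cong (λ l → xs ++ c ∷ l ++ r) eq₁ ⟩
        xs ++ c ∷ (w₁ ++ e ∷ w ++ f ∷ w₃) ++ r    ≡⟨ cong (λ l → xs ++ c ∷ l) (++-assoc w₁ _ r) ⟩
        xs ++ c ∷ w₁ ++ e ∷ (w ++ f ∷ w₃) ++ r    ≡⟨ cong (λ l → xs ++ c ∷ w₁ ++ e ∷ l) (++-assoc w _ r) ⟩
        xs ++ c ∷ w₁ ++ e ∷ w ++ f ∷ w₃ ++ r      ≡⟨ ++-assoc xs (c ∷ w₁) _ ⟨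
        (xs ++ c ∷ w₁) ++ e ∷ w ++ f ∷ w₃ ++ r    ∎

    -- With 4 neighbours the cycle could be shortened: a vertex off the cycle replaces at least two
    -- vertices between its first and fourth neighbour; a vertex of the stretch has two neighbours
    -- on one side, and the chord to the farther one skips a vertex.
    few-neighbours : ∀ {x} → x ∈ W ++ u ++ [ s ] → deg G x (u ++ [ s ]) ≤ 3
    few-neighbours {x} x∈ with deg G x (u ++ [ s ]) ≤? 3
    ... | yes le = le
    ... | no ¬le with ∈-++⁻ W x∈
    ... | inj₁ x∈W with filter-split-first (Adj? x) (u ++ [ s ]) (≰⇒> ¬le)
    ...   | w₁ , e , m , eq₁ , xe , le with filter-split-last (Adj? x) 2 m le
    ...   | w , f , w₃ , refl , xf , le′ =
      ⊥-elim (no-shortcut w₁ e w f w₃ eq₁ [ x ] (Adj-sym xe ∷ xf ∷ [-]) ([] ∷ []) (∈-outside⁻ x∈W ∷ []) le′)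
    few-neighbours {x} x∈ | no ¬le | inj₂ x∈us with ∈-∃++ x∈us
    ... | a , b , eq₁ = ⊥-elim (two-sides (≤-total 2 (deg G x a)))
      where
      deg-self : deg G x [ x ] ≡ 0
      deg-self with deg-positive x [ x ]
      ... | inj₁ z = z
      ... | inj₂ (_ , here refl , xx) = contradiction refl (Adj⇒≢ xx)
      total : 4 ≤ deg G x a + deg G x b
      total = begin
        4                                         ≤⟨ ≰⇒> ¬le ⟩
        deg G x (u ++ [ s ])                      ≡⟨ cong (deg G x) eq₁ ⟩
        deg G x (a ++ x ∷ b)                      ≡⟨ deg-++ x a (x ∷ b) ⟩
        deg G x a + deg G x (x ∷ b)               ≡⟨ cong (deg G x a +_) (deg-++ x [ x ] b) ⟩
        deg G x a + (deg G x [ x ] + deg G x b)   ≡⟨ cong (λ m → deg G x a + (m + deg G x b)) deg-self ⟩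
        deg G x a + deg G x b                     ∎
        where open ≤-Reasoning
      two-sides : 2 ≤ deg G x a ⊎ deg G x a ≤ 2 → ⊥
      two-sides (inj₁ le) with filter-split-first (Adj? x) a le
      ... | w₁ , e , w , refl , xe , le′ = no-shortcut w₁ e w x b (≡.trans eq₁ (++-assoc w₁ (e ∷ w) (x ∷ b)))
        [] (Adj-sym xe ∷ [-]) [] [] (≤-trans le′ (length-filter (Adj? x) w))
      two-sides (inj₂ le) with filter-split-last (Adj? x) 1 b (+-cancelˡ-≤ 2 _ _ (≤-trans total (+-monoˡ-≤ (deg G x b) le)))
      ... | w , f , w₃ , refl , xf , le′ = no-shortcut a x w f w₃ eq₁ [] (xf ∷ [-]) [] [] le′

    -- If `x` is off the cycle, `s` must be a neighbour of it because `u` is harmless; as `s` is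
    -- unattached, the walk from `s` over `x` to `z` is free. If `x` is on the stretch, it serves as
    -- the exit.
    neighbour-territory : ∀ {x} → x ∈ W ++ u ++ [ s ] → cap x ≤ deg G x (W ++ u ++ [ s ]) →
      ∀ {z} → z ∈ W → Adj G x z → Territory c z
    neighbour-territory {x} x∈ le {z} z∈W xz with ∈-++⁻ W x∈
    ... | inj₁ x∈W with new-neighbour u [ s ] (∈-++⁺ˡ x∈W) ok
                       (≤-trans le (≤-reflexive (≡.trans (cong (deg G x) (≡.sym (++-assoc W u [ s ]))) (deg-++ x (W ++ u) [ s ]))))
    ...   | _ , here refl , xs = territory eq ¬u ¬s ok
        (∈-outside⁻ z∈W , λ Az → ¬Ax (Reach-snoc Az (Adj-sym xz) (∈-outside⁻ x∈W)))
        (Adj-sym xs ∷⟨ ∈-outside⁻ x∈W , ¬Ax ⟩ edge xz)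
      where
      ¬Ax : ¬ A x
      ¬Ax Ax = ¬s (x , Ax , Adj-sym xs)
    neighbour-territory {x} x∈ le {z} z∈W xz | inj₂ x∈us with ∈-∃++ x∈us
    ... | a , b , eq₁ with init-prefix u a eq₁
    ... | w , eq₂ = territory D≡ (AllP.++⁻ˡ a (subst (All (¬_ ∘ Att)) eq₂ ¬u)) ¬x (OK-prefix a w (subst OK eq₂ ok))
        (∈-outside⁻ z∈W , λ Az → ¬x (z , Az , xz)) (edge xz)
      where
      open ≡-Reasoning
      ¬x : ¬ Att x
      ¬x = All.lookup (AllP.++⁺ ¬u (¬s ∷ [])) x∈us
      D≡ : D ≡ xs ++ c ∷ a ++ x ∷ b ++ r
      D≡ = begin
        D                               ≡⟨ eq ⟩
        xs ++ c ∷ u ++ s ∷ r            ≡⟨ cong (λ l → xs ++ c ∷ l) (++-assoc u [ s ] r) ⟨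
        xs ++ c ∷ (u ++ [ s ]) ++ r     ≡⟨ cong (λ l → xs ++ c ∷ l ++ r) eq₁ ⟩
        xs ++ c ∷ (a ++ x ∷ b) ++ r     ≡⟨ cong (λ l → xs ++ c ∷ l) (++-assoc a (x ∷ b) r) ⟩
        xs ++ c ∷ a ++ x ∷ b ++ r       ∎

  -- The set consists of the neighbours off the cycle of a vertex `x` that reaches its cap when `s`
  -- is uncovered; at most 3 further neighbours lie on the stretch.
  large-territory : ∀ {c} → c ∈ D → Att c → ∃ λ L → Unique L × d ∸ 3 ≤ length L × All (_∈ W) L × All (Territory c) L
  large-territory {c} c∈ ac with ∈-∃++ c∈
  ... | xs , ys , eq with find-exit xs c [] ys eq ac [] harmless-[]
  ... | u , s , r , eq′ , ¬u , ¬s , ok , ¬ok with ¬OK⇒witness (u ++ [ s ]) ¬ok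
  ... | x , x∈ , le = filter (Adj? x) W , Unique.filter⁺ (Adj? x) (outside-Unique C) , m≤n+o⇒m∸n≤o _ 3 size ,
      All.tabulate (λ z∈ → proj₁ (∈-filter⁻ (Adj? x) {xs = W} z∈)) ,
      All.tabulate (λ z∈ → let z∈W , xz = ∈-filter⁻ (Adj? x) {xs = W} z∈ in
        neighbour-territory eq′ ¬u ¬s ok x∈ le z∈W xz)
    where
    open ≤-Reasoning
    size : d ≤ 3 + deg G x W
    size = begin
      d                                    ≤⟨ ≤-trans (d≤cap x) le ⟩
      deg G x (W ++ u ++ [ s ])            ≡⟨ deg-++ x W (u ++ [ s ]) ⟩
      deg G x W + deg G x (u ++ [ s ])     ≤⟨ +-monoʳ-≤ (deg G x W) (few-neighbours eq′ ¬u ¬s ok x∈) ⟩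
      deg G x W + 3                        ≡⟨ +-comm (deg G x W) 3 ⟩
      3 + deg G x W                        ∎

  union-of-territories : ∀ {cs} → Unique cs → All (_∈ D) cs → All Att cs →
    ∃ λ Z → Unique Z × length cs * (d ∸ 3) ≤ length Z × All (_∈ W) Z × All (λ z → ∃ λ c → c ∈ cs × Territory c z) Z
  union-of-territories [] [] [] = [] , [] , z≤n , [] , []
  union-of-territories (c∉ ∷ u) (c∈D ∷ cs∈D) (ac ∷ acs) with large-territory c∈D ac | union-of-territories u cs∈D acs
  ... | L , uL , leL , L⊆W , tL | Z , uZ , leZ , Z⊆W , tZ = L ++ Z ,
    Unique.++⁺ uL uZ (λ { (z∈L , z∈Z) → let c′ , c′∈ , t′ = All.lookup tZ z∈Z in
      territories-disjoint ac (All.lookup acs c′∈) (All.lookup c∉ c′∈) (All.lookup tL z∈L) t′ }) ,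
    ≤-trans (+-mono-≤ leL leZ) (≤-reflexive (≡.sym (length-++ L))) ,
    AllP.++⁺ L⊆W Z⊆W ,
    AllP.++⁺ (All.map (λ t → _ , here refl , t) tL) (All.map (λ { (c′ , c′∈ , t′) → c′ , there c′∈ , t′ }) tZ)

  -- Connectivity and the count of vertices off the cycle.

  attachments : List V
  attachments = filter Att? C

  -- Deleting the attachments separates `v` from the unattached exit `s` on the cycle, which is
  -- impossible if there are fewer than `k`.
  many-attachments : ∀ {k} → KConnected k G → ∀ {c} → c ∈ D → Att c → k ≤ length attachments
  many-attachments {k} (_ , conn) {c} c∈ ac with k ≤? length attachments
  ... | yes le = le
  ... | no ¬le with ∈-∃++ c∈
  ... | xs , ys , eq with find-exit xs c [] ys eq ac [] harmless-[]
  ... | u , s , r , eq′ , _ , ¬s , _ = ⊥-elim (A⇒∉C (stay here (conn attachments (≰⇒> ¬le) v s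
          (λ v∈ → v∉C (proj₁ (∈-filter⁻ Att? {xs = C} v∈))) (λ s∈ → ¬s (proj₂ (∈-filter⁻ Att? {xs = C} s∈))))) s∈C)
    where
    s∈C : s ∈ C
    s∈C = ∈-resp-↭ D↭C (subst (s ∈_) (≡.sym eq′) (∈-++⁺ʳ xs (there (∈-++⁺ʳ u (here refl)))))
    -- Leaving the component means stepping onto an attached vertex of the cycle, and these are
    -- deleted.
    stay : ∀ {x w} → A x → Reach G attachments x w → A w
    stay Ax here = Ax
    stay {x} Ax (step {w = y} xy y∉ r) with DecMem._∈?_ Fin._≟_ y C
    ... | yes y∈C = contradiction (∈-filter⁺ Att? y∈C (x , Ax , Adj-sym xy)) y∉
    ... | no y∉C = stay (Reach-snoc Ax xy y∉C) r

  -- The neighbours of `v` off the cycle lie in its component and the territories do not, so the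
  -- counts add up.
  many-uncovered : ∀ {k} → KConnected k G → ∀ {c} → c ∈ D → Att c → d ≤ deg G v W → d + k * (d ∸ 3) ≤ length W
  many-uncovered {k} kc c∈ ac le with union-of-territories (Unique.filter⁺ Att? C-unique)
      (All.tabulate (λ c∈ → ∈-resp-↭ (↭-sym D↭C) (proj₁ (∈-filter⁻ Att? {xs = C} c∈))))
      (All.tabulate (λ c∈ → proj₂ (∈-filter⁻ Att? {xs = C} c∈)))
  ... | Z , uZ , leZ , Z⊆W , tZ = begin
    d + k * (d ∸ 3)                          ≤⟨ +-mono-≤ le (≤-trans (*-monoˡ-≤ (d ∸ 3) (many-attachments kc c∈ ac)) leZ) ⟩
    deg G v W + length Z                     ≡⟨ length-++ (filter (Adj? v) W) ⟨
    length (filter (Adj? v) W ++ Z)          ≤⟨ Unique-⊆-length unique (λ z∈ → All.lookup sub z∈) ⟩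
    length W                                 ∎
    where
    open ≤-Reasoning
    unique : Unique (filter (Adj? v) W ++ Z)
    unique = Unique.++⁺ (Unique.filter⁺ (Adj? v) (outside-Unique C)) uZ λ { (z∈N , z∈Z) →
      let z∈W , vz = ∈-filter⁻ (Adj? v) {xs = W} z∈N
          _ , _ , t = All.lookup tZ z∈Z
      in proj₂ (T.free t) (step vz (∈-outside⁻ z∈W) here) }
    sub : All (_∈ W) (filter (Adj? v) W ++ Z)
    sub = AllP.++⁺ (All.tabulate (λ z∈ → proj₁ (∈-filter⁻ (Adj? v) {xs = W} z∈))) Z⊆W

-- The threshold is 2 where `IsCycle` has 3: an edge closes up by symmetry, so edges and longer
-- cycles are treated alike.
Closed : (G : Graph) → List (Fin (n G)) → Set
Closed G C = 2 ≤ length C → ∀ a b → head C ≡ just a → last C ≡ just b → Adj G b a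

-- Rotation and decidability of cycles.

module _ (G : Graph) where

  open InGraph G

  private
    V = Fin (n G)

  IsCycle⇒Closed : ∀ {C} → IsCycle G C → Closed G C
  IsCycle⇒Closed {x ∷ []}        _                 (s≤s ())
  IsCycle⇒Closed {x ∷ y ∷ []}    (_ , xy ∷ _ , _)  _ _ _ refl refl = Adj-sym xy
  IsCycle⇒Closed {x ∷ y ∷ z ∷ _} (_ , _ , closing) _ = closing (s≤s (s≤s (s≤s z≤n)))

  -- The old closing edge joins the two pieces, and the old edge into `c` becomes the closing edge.
  rotate : ∀ xs c ys → Linked (Adj G) (xs ++ c ∷ ys) → Closed G (xs ++ c ∷ ys) →
    Linked (Adj G) (c ∷ ys ++ xs) × Closed G (c ∷ ys ++ xs)
  rotate []       c ys lk cl rewrite ++-identityʳ ys = lk , cl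
  rotate (x ∷ xs) c ys lk cl =
    Linked-glue (c ∷ ys) (Linked-snoc (c ∷ ys) (Linked-++⁻ʳ (x ∷ xs) lk) join) (Linked-init (x ∷ xs) lk′) ,
    λ { _ a b refl lb → Linked-last (x ∷ xs) lk′ (≡.trans (≡.sym (last-++ (c ∷ ys))) lb) }
    where
    lk′ : Linked (Adj G) ((x ∷ xs) ++ [ c ])
    lk′ = Linked-++⁻ˡ (x ∷ xs) lk
    join : ∀ b → last (c ∷ ys) ≡ just b → Adj G b x
    join b lb = cl (s≤s (1≤length-++-∷ xs)) x b refl (≡.trans (last-++ (x ∷ xs)) lb)

  closing? : ∀ h l → Dec (∀ a b → h ≡ just a → l ≡ just b → Adj G b a)
  closing? nothing  _        = yes λ _ _ ()
  closing? (just a) nothing  = yes λ _ _ _ ()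
  closing? (just a) (just b) = map′ (λ { p _ _ refl refl → p }) (λ f → f a b refl refl) (Adj? b a)

  IsCycle? : ∀ C → Dec (IsCycle G C)
  IsCycle? C = DecUnique.unique? Fin._≟_ C ×-dec Linked.linked? Adj? C ×-dec
    ((3 ≤? length C) →-dec closing? (head C) (last C))

  -- Vertices of maximum degree and sizes of components.

  Bounded : ℕ → List V → Set
  Bounded d C = All (λ z → deg G z (outside G C) ≤ d) (outside G C)

  -- Under `Bounded d C` these have degree exactly `d`; their number is the second measure of the
  -- descent.
  tops : ℕ → List V → List V
  tops d C = filter (λ z → d ≤? deg G z (outside G C)) (outside G C)

  ∈-tops⁻ : ∀ d C {z} → z ∈ tops d C → z ∈ outside G C × d ≤ deg G z (outside G C)
  ∈-tops⁻ d C = ∈-filter⁻ (λ z → d ≤? deg G z (outside G C)) {xs = outside G C}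

  ∈-tops⁺ : ∀ d C {z} → z ∉ C → d ≤ deg G z (outside G C) → z ∈ tops d C
  ∈-tops⁺ d C z∉ = ∈-filter⁺ (λ z → d ≤? deg G z (outside G C)) (∈-outside⁺ z∉)

  tops-Unique : ∀ d C → Unique (tops d C)
  tops-Unique d C = Unique.filter⁺ (λ z → d ≤? deg G z (outside G C)) (outside-Unique C)

  maxDegMinus-≤ : ∀ {d C} → Bounded d C → maxDegMinus G C ≤ d
  maxDegMinus-≤ {d} {C} = go (outside G C)
    where
    go : ∀ l → All (λ z → deg G z (outside G C) ≤ d) l → foldr _⊔_ 0 (map (degMinus G C) l) ≤ d
    go []      []       = z≤n
    go (x ∷ l) (p ∷ ps) = ⊔-lub p (go l ps)

  component-size : {P : V → Set} → Decidable P → ℕ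
  component-size P? = length (filter P? (allFin (n G)))

  component-size-≤ : ∀ {P Q : V → Set} (P? : Decidable P) (Q? : Decidable Q) → (∀ {z} → P z → Q z) →
    component-size P? ≤ component-size Q?
  component-size-≤ P? Q? P⇒Q = Unique-⊆-length (Unique.filter⁺ P? (Unique.allFin⁺ _)) λ z∈ →
    ∈-filter⁺ Q? (∈-allFin _) (P⇒Q (proj₂ (∈-filter⁻ P? {xs = allFin _} z∈)))

  component-size-< : ∀ {P Q : V → Set} (P? : Decidable P) (Q? : Decidable Q) → (∀ {z} → P z → Q z) →
    ∀ {a} → ¬ P a → Q a → component-size P? < component-size Q?
  component-size-< P? Q? P⇒Q {a} ¬Pa Qa = Unique-⊆-length
    (AllP.¬Any⇒All¬ _ (λ a∈ → ¬Pa (proj₂ (∈-filter⁻ P? {xs = allFin _} a∈))) ∷ Unique.filter⁺ P? (Unique.allFin⁺ _))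
    λ { (here refl) → ∈-filter⁺ Q? (∈-allFin _) Qa
      ; (there z∈)  → ∈-filter⁺ Q? (∈-allFin _) (P⇒Q (proj₂ (∈-filter⁻ P? {xs = allFin _} z∈))) }

  -- Descent to a minimal configuration.

  module Descent (k : ℕ) (1≤k : 1 ≤ k) (kc : KConnected k G)
    (no-good : ∀ C → IsCycle G C → ¬ (k + 1) * maxDegMinus G C ≤ sizeMinus G C + 3 * (k + 1)) where

    -- `(k + 1) * d` is at most `d + k * (d ∸ 3) + 3 * k`, also when `d < 3` and the subtraction is
    -- truncated. This contradicts `no-good` with 3 to spare.
    many-uncovered⇒⊥ : ∀ {d C} → IsCycle G C → Bounded d C → ¬ d + k * (d ∸ 3) ≤ sizeMinus G C
    many-uncovered⇒⊥ {d} {C} cyc bd le = no-good C cyc (begin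
      (k + 1) * maxDegMinus G C              ≤⟨ *-monoʳ-≤ (k + 1) (maxDegMinus-≤ {d} {C} bd) ⟩
      (k + 1) * d                            ≡⟨ *-distribʳ-+ d k 1 ⟩
      k * d + 1 * d                          ≡⟨ cong (k * d +_) (*-identityˡ d) ⟩
      k * d + d                              ≡⟨ +-comm (k * d) d ⟩
      d + k * d                              ≤⟨ +-monoʳ-≤ d (*-monoʳ-≤ k (m≤n+m∸n d 3)) ⟩
      d + k * (3 + (d ∸ 3))                  ≡⟨ cong (d +_) (*-distribˡ-+ k 3 (d ∸ 3)) ⟩
      d + (k * 3 + k * (d ∸ 3))              ≡⟨ cong (d +_) (+-comm (k * 3) _) ⟩
      d + (k * (d ∸ 3) + k * 3)              ≡⟨ +-assoc d _ _ ⟨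
      d + k * (d ∸ 3) + k * 3                ≤⟨ +-mono-≤ le (≤-trans (≤-reflexive (*-comm k 3)) (*-monoʳ-≤ 3 (m≤m+n k 1))) ⟩
      sizeMinus G C + 3 * (k + 1)            ∎)
      where open ≤-Reasoning

    -- State of the inner descent. The decision `A?` is stored so that the component has a numerical
    -- size.
    record Config (d M : ℕ) : Set where
      field
        C       : List V
        cycle   : IsCycle G C
        bounded : Bounded d C
        few     : length (tops d C) ≤ suc M
        v       : V
        v∉C     : v ∉ C
        d≤v     : d ≤ deg G v (outside G C)
        A?      : ∀ z → Dec (Reach G C v z)

      size : ℕ
      size = component-size A?

    Smaller : ∀ {d M} → Config d M → Config d M → Set
    Smaller s′ s = size s′ < size s ⊎ size s′ ≤ size s × length (C s′) < length (C s)
      where open Config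

    module _ {d M : ℕ} (fewer-tops : ∀ C → IsCycle G C → Bounded d C → length (tops d C) ≤ M → ⊥) where

      module Minimal (s : Config d M) (minimal : ∀ s′ → ¬ Smaller s′ s) where

        open Config s

        W : List V
        W = outside G C

        Att? : ∀ c → Dec (Attached G C v c)
        Att? c = Fin.any? (λ a → A? a ×-dec Adj? c a)

        top? : ∀ z → Dec (z ∈ tops d C)
        top? z = DecMem._∈?_ Fin._≟_ z (tops d C)

        -- With this cap a harmless change creates no vertex of degree at least d and raises none above d.
        cap : V → ℕ
        cap z = if does (top? z) then suc d else d

        d≤cap : ∀ z → d ≤ cap z
        d≤cap z with top? z
        ... | yes _ = n≤1+n d
        ... | no _  = ≤-refl

        <cap⇒≤ : ∀ z {m} → m < cap z → m ≤ d
        <cap⇒≤ z lt with top? z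
        ... | yes _ = s≤s⁻¹ lt
        ... | no _  = <⇒≤ lt

        <cap⇒top : ∀ z {m} → m < cap z → d ≤ m → z ∈ tops d C
        <cap⇒top z lt le with top? z
        ... | yes top = top
        ... | no _    = ⊥-elim (<⇒≱ lt le)

        below-cap : ∀ {z} → z ∈ W → deg G z W < cap z
        below-cap {z} z∈ with top? z
        ... | yes _  = s≤s (All.lookup bounded z∈)
        ... | no ¬top = ≰⇒> (λ le → ¬top (∈-tops⁺ d C (∈-outside⁻ z∈) le))

        harmless-[] : Harmless G C cap []
        harmless-[] rewrite ++-identityʳ W = All.tabulate below-cap

        -- Harmlessness keeps the bound `d` and creates no new top. If `v` ceases to be a top,
        -- `fewer-tops` applies; otherwise the new cycle with the same `v` is a smaller
        -- configuration.
        no-improvement : NoImprovement G C v cap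
        no-improvement C′ u cyc′ hl ¬att cover prog = by-cases (DecMem._∈?_ Fin._≟_ v (tops d C′))
          where
          W′ : List V
          W′ = outside G C′

          W′⊆ : ∀ {z} → z ∈ W′ → z ∈ W ++ u
          W′⊆ {z} z∈ with DecMem._∈?_ Fin._≟_ z C
          ... | no z∉C = ∈-++⁺ˡ (∈-outside⁺ z∉C)
          ... | yes z∈C with cover z∈C
          ...   | inj₁ z∈C′ = contradiction z∈C′ (∈-outside⁻ z∈)
          ...   | inj₂ z∈u  = ∈-++⁺ʳ W z∈u

          deg<cap : ∀ {z} → z ∈ W′ → deg G z W′ < cap z
          deg<cap {z} z∈ = ≤-<-trans (deg-⊆ z (outside-Unique C′) W′⊆) (All.lookup hl (W′⊆ z∈))

          bd′ : Bounded d C′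
          bd′ = All.tabulate λ {z} z∈ → <cap⇒≤ z (deg<cap z∈)

          tops⊆ : ∀ {z} → z ∈ tops d C′ → z ∈ tops d C
          tops⊆ {z} z∈ = let z∈W′ , le = ∈-tops⁻ d C′ z∈ in <cap⇒top z (deg<cap z∈W′) le

          -- A walk could leave the old component only through an uncovered vertex, which would then
          -- be attached.
          component⊆ : ∀ {x z} → Reach G C v x → Reach G C′ x z → Reach G C v z
          component⊆ vx here = vx
          component⊆ {x} vx (step {w = y} xy y∉C′ r) with DecMem._∈?_ Fin._≟_ y C
          ... | no y∉C = component⊆ (Reach-snoc vx xy y∉C) r
          ... | yes y∈C with cover y∈C
          ...   | inj₁ y∈C′ = contradiction y∈C′ y∉C′
          ...   | inj₂ y∈u  = contradiction (x , vx , Adj-sym xy) (All.lookup ¬att y∈u)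

          by-cases : Dec (v ∈ tops d C′) → ⊥
          by-cases (no v∉) = fewer-tops C′ cyc′ bd′ (s≤s⁻¹ (≤-trans
            (Unique-⊆-length (AllP.¬Any⇒All¬ _ v∉ ∷ tops-Unique d C′)
              λ { (here refl) → ∈-tops⁺ d C v∉C d≤v ; (there z∈) → tops⊆ z∈ }) few))
          by-cases (yes v∈) = ¬¬∀-Dec (Reach G C′ v) λ A′? →
            let v∈W′ , d≤v′ = ∈-tops⁻ d C′ v∈
                v∉C′ = ∈-outside⁻ v∈W′
            in minimal
              (record { C = C′ ; cycle = cyc′ ; bounded = bd′
                      ; few = ≤-trans (Unique-⊆-length (tops-Unique d C′) tops⊆) few
                      ; v = v ; v∉C = v∉C′ ; d≤v = d≤v′ ; A? = A′? })
              (progress v∉C′ A′? prog)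
            where
            progress : v ∉ C′ → (A′? : ∀ z → Dec (Reach G C′ v z)) →
              (∃ λ a → Reach G C v a × a ∈ C′) ⊎ length C′ < length C →
              component-size A′? < component-size A? ⊎ component-size A′? ≤ component-size A? × length C′ < length C
            progress v∉C′ A′? (inj₁ (a , Aa , a∈C′)) =
              inj₁ (component-size-< A′? A? (component⊆ here) (λ A′a → Reach-avoids v∉C′ A′a a∈C′) Aa)
            progress v∉C′ A′? (inj₂ lt) = inj₂ (component-size-≤ A′? A? (component⊆ here) , lt)

        -- With no attached vertex on `C`, the component of `v` is closed under adjacency. As
        -- `1 ≤ k`, the empty separator shows that it is the whole graph, so `C` is empty.
        attached-exists : Dec (Any (Attached G C v) C) → C ≢ [] → Any (Attached G C v) C
        attached-exists (yes found) _ = found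
        attached-exists (no none) C≢[] = ⊥-elim (C≢[] (empty C (λ z∈ → z∈)))
          where
          stay : ∀ {x z} → Reach G C v x → Reach G [] x z → Reach G C v z
          stay vx here = vx
          stay {x} vx (step {w = y} xy _ r) with DecMem._∈?_ Fin._≟_ y C
          ... | no y∉C  = stay (Reach-snoc vx xy y∉C) r
          ... | yes y∈C = contradiction (Any.map (λ { refl → x , vx , Adj-sym xy }) y∈C) none
          empty : ∀ l → (∀ {z} → z ∈ l → z ∈ C) → l ≡ []
          empty []      _   = refl
          empty (z ∷ l) sub = ⊥-elim (Reach-avoids v∉C
            (stay here (proj₂ kc [] 1≤k v z (λ ()) (λ ()))) (sub (here refl)))

        -- Otherwise the single vertex `v`, taken as a cycle, would be an improvement.
        C≢[] : C ≢ []
        C≢[] C≡[] = no-improvement [ v ] [] ([] ∷ [] , [-] , λ { (s≤s ()) }) harmless-[] []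
          (λ {z} z∈ → ⊥-elim (∉[] (subst (z ∈_) C≡[] z∈))) (inj₁ (v , here , here refl))

        impossible : ⊥
        impossible with find (attached-exists (Any.any? Att? C) C≢[])
        ... | c , c∈ , ac with ∈-∃++ c∈
        ... | xs , ys , eq with rotate xs c ys (subst (Linked (Adj G)) eq (proj₁ (proj₂ cycle))) (subst (Closed G) eq (IsCycle⇒Closed cycle))
        ... | lk , cl = many-uncovered⇒⊥ cycle bounded (many-uncovered kc (here refl) ac d≤v)
          where
          rotated : c ∷ ys ++ xs ↭ C
          rotated = ↭-trans (++-comm (c ∷ ys) xs) (↭-reflexive (≡.sym eq))
          head-attached : ∀ h → just c ≡ just h → Attached G C v h
          head-attached _ refl = ac
          open Extremal G C (c ∷ ys ++ xs) rotated (proj₁ cycle) lk cl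
            v v∉C A? head-attached d cap d≤cap harmless-[] no-improvement

      -- Lexicographic induction on component size and cycle length; a smaller component resets the
      -- length bound.
      descend : ∀ a ℓ (s : Config d M) → Config.size s < a → length (Config.C s) < ℓ → ⊥
      descend (suc a) (suc ℓ) s size<a len<ℓ = Minimal.impossible s λ s′ → Sum.[
        (λ lt → descend a _ s′ (≤-trans lt (s≤s⁻¹ size<a)) ≤-refl) ,
        (λ (le , lt) → descend (suc a) ℓ s′ (≤-trans (s≤s le) size<a) (≤-trans lt (s≤s⁻¹ len<ℓ))) ]

    -- Outer induction on `d`, then on the number of tops. Without tops the degree bound drops by
    -- one and `M` is reset; otherwise the inner descent starts at a top.
    no-cycle : ∀ d M C → IsCycle G C → Bounded d C → ¬ length (tops d C) ≤ M
    no-cycle d M C cyc bd few with tops d C in eq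
    -- For `d = 0` the required lower bound on the size is 0.
    no-cycle zero M C cyc bd few | [] = many-uncovered⇒⊥ cyc bd (≤-trans (≤-reflexive (*-zeroʳ k)) z≤n)
    no-cycle (suc d) M C cyc bd few | [] = no-cycle d _ C cyc
      (All.tabulate λ {z} z∈ → s≤s⁻¹ (≰⇒> λ le → ∉[] (subst (z ∈_) eq (∈-tops⁺ (suc d) C (∈-outside⁻ z∈) le)))) ≤-refl
    no-cycle d (suc M) C cyc bd few | v ∷ vs =
      ¬¬∀-Dec (Reach G C v) λ A? → descend (no-cycle d M) _ _
        (record { C = C ; cycle = cyc ; bounded = bd ; few = subst (λ l → length l ≤ suc M) (≡.sym eq) few
                ; v = v ; v∉C = ∈-outside⁻ (proj₁ v-top) ; d≤v = proj₂ v-top ; A? = A? }) ≤-refl ≤-refl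
      where
      v-top = ∈-tops⁻ d C (subst (v ∈_) (≡.sym eq) (here refl))

-- Extraction of the cycle by bounded search.

theorem1p4 : (k : ℕ) → 1 ≤ k → (G : Graph) → KConnected k G →
    Σ (List (Fin (n G))) λ C → IsCycle G C ×
      ((k + 1) * maxDegMinus G C ≤ sizeMinus G C + 3 * (k + 1))
-- A cycle has at most `n G` vertices, so existence is decidable and the double negation can be
-- removed.
theorem1p4 k 1≤k G kc = let C , _ , good = decidable-stable (∃-list≤? (n G) good?) ¬¬good in C , good
  where
  Good : List (Fin (n G)) → Set
  Good C = IsCycle G C × ((k + 1) * maxDegMinus G C ≤ sizeMinus G C + 3 * (k + 1))
  good? : ∀ C → Dec (Good C)
  good? C = IsCycle? G C ×-dec (_ ≤? _)
  length≤n : ∀ {C} → Unique C → length C ≤ n G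
  length≤n u = ≤-trans (Unique-⊆-length u (λ _ → ∈-allFin _)) (≤-reflexive (length-tabulate id))
  ¬¬good : ¬ ¬ ∃ λ C → length C ≤ n G × Good C
  -- The descent starts from the empty cycle, with the number of vertices as a trivial degree bound.
  ¬¬good none = no-cycle (length (outside G [])) _ [] ([] , [] , λ ())
    (All.tabulate λ {z} _ → length-filter (InGraph.Adj? G z) (outside G [])) ≤-refl
    where
    no-good : ∀ C → IsCycle G C → ¬ (k + 1) * maxDegMinus G C ≤ sizeMinus G C + 3 * (k + 1)
    no-good C cyc le = none (C , length≤n (proj₁ cyc) , cyc , le)
    open Descent G k 1≤k kc no-good
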